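{- If $G=(V,E)$ is a connected $2$-distance graph, then $\omega(G) \leq |V| - 3$.
   Context: Graphs are finite, simple and undirected; $d_H(u,v)$ denotes geodesic distance (length of a shortest path) in $H$. The $2$-distance operator $D^2$ sends a graph $H$ to the graph $D^2(H)$ on the same vertex set in which $u,v$ are adjacent if and only if $d_H(u,v)=2$. A graph $G$ is a $2$-distance graph if there exists a graph $H$ with $G \cong D^2(H)$. $\omega(G)$ is the clique number of $G$, the size of a largest clique in $G$.
   Formalization: The graph G is assumed to have at least two vertices; for the one-vertex graph, which is a connected 2-distance graph with clique number 1, the stated inequality fails. -}

module Defs where

open import Data.Fin.Base using (Fin)
open import Data.Fin.Properties using (_≟_; all?; any?)
open import Data.Fin.Subset using (Subset; _∈_; ∣_∣; ⊥)
open import Data.Fin.Subset.Properties using (_∈?_; anySubset?; ∣p∣≤n; ∣⊥∣≡0; ∉⊥)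
open import Data.List.Base using (List; []; _∷_)
open import Data.List.Relation.Unary.All using ([]; _∷_)
open import Data.List.Relation.Unary.AllPairs using ([]; _∷_)
open import Data.List.Relation.Unary.Unique.Propositional using (Unique)
open import Data.Nat.Base using (ℕ; zero; suc; _≤_; z≤n; s≤s)
import Data.Nat.Properties as ℕ
open import Data.Product.Base using (Σ; ∃; ∃-syntax; _×_; _,_; proj₁)
open import Data.Sum.Base using (inj₁; inj₂)
open import Function.Base using (_∘_)
open import Function.Bundles using (_↔_; _⇔_; module Inverse)
open import Level using (0ℓ)
open import Relation.Binary.Core using (Rel)
open import Relation.Binary.Definitions using (Symmetric; Irreflexive; Decidable)
open import Relation.Binary.PropositionalEquality using (_≡_; _≢_; refl; sym)
open import Relation.Nullary using (Dec; yes; no)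
open import Relation.Nullary.Decidable using (map′; ¬?; _×-dec_; _→-dec_)
open import Relation.Nullary.Negation using (¬_; contradiction)

-- A finite simple graph with n vertices, labelled by Fin n. Decidability of
-- adjacency is automatic classically; constructively it is part of finiteness.

record Graph (n : ℕ) : Set₁ where
  field
    Adj        : Rel (Fin n) 0ℓ
    adj-sym    : Symmetric Adj
    adj-irrefl : Irreflexive _≡_ Adj
    adj?       : Decidable Adj

open Graph public

private
  variable
    n m k : ℕ
    u v w : Fin n

data Walk (G : Graph n) : Fin n → Fin n → ℕ → Set where
  []  : Walk G u u 0
  _∷_ : Adj G u w → Walk G w v k → Walk G u v (suc k)

vertices : {G : Graph n} → Walk G u v k → List (Fin n)
vertices {u = u} []      = u ∷ []
vertices {u = u} (_ ∷ p) = u ∷ vertices p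

Path : Graph n → Fin n → Fin n → ℕ → Set
Path G u v k = Σ (Walk G u v k) λ p → Unique (vertices p)

Connected : Graph n → Set
Connected G = ∀ u v → ∃[ k ] Path G u v k

-- The geodesic distance from u to v is k. Vertices in different components
-- are at no (finite) distance.

IsDistance : Graph n → Fin n → Fin n → ℕ → Set
IsDistance G u v k = Path G u v k × (∀ j → Path G u v j → k ≤ j)

distance₂-sym : (H : Graph n) → IsDistance H u v 2 → IsDistance H v u 2
distance₂-sym {u = u} {v} H
  (((a ∷ b ∷ []) , ((u≢w ∷ u≢v ∷ []) ∷ (w≢v ∷ []) ∷ _)) , shortest) =
  ((adj-sym H b ∷ adj-sym H a ∷ []) ,
   ((w≢v ∘ sym) ∷ (u≢v ∘ sym) ∷ []) ∷ ((u≢w ∘ sym) ∷ []) ∷ [] ∷ []) , shortest′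
  where
  shortest′ : ∀ j → Path H v u j → 2 ≤ j
  shortest′ 0 ([] , _) = contradiction refl u≢v
  shortest′ 1 ((c ∷ []) , _) =
    shortest 1 ((adj-sym H c ∷ []) , (u≢v ∷ []) ∷ [] ∷ [])
  shortest′ (suc (suc _)) _ = s≤s (s≤s z≤n)

distance₂-irrefl : (H : Graph n) → Irreflexive _≡_ (λ u v → IsDistance H u v 2)
distance₂-irrefl H refl (_ , shortest) with () ← shortest 0 ([] , [] ∷ [])

distance₂? : (H : Graph n) → Decidable (λ u v → IsDistance H u v 2)
distance₂? {n} H u v = map′ to from
  (¬? (u ≟ v) ×-dec ¬? (adj? H u v) ×-dec any? λ w → adj? H u w ×-dec adj? H w v)
  where
  Local : Set
  Local = u ≢ v × ¬ Adj H u v × (∃[ w ] (Adj H u w × Adj H w v))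

  adj⇒≢ : ∀ {x y} → Adj H x y → x ≢ y
  adj⇒≢ a x≡y = adj-irrefl H x≡y a

  to : Local → IsDistance H u v 2
  to (u≢v , ¬uv , w , a , b) =
    ((a ∷ b ∷ []) , (adj⇒≢ a ∷ u≢v ∷ []) ∷ (adj⇒≢ b ∷ []) ∷ [] ∷ []) , shortest
    where
    shortest : ∀ j → Path H u v j → 2 ≤ j
    shortest 0 ([] , _) = contradiction refl u≢v
    shortest 1 ((c ∷ []) , _) = contradiction c ¬uv
    shortest (suc (suc _)) _ = s≤s (s≤s z≤n)

  from : IsDistance H u v 2 → Local
  from (((a ∷ b ∷ []) , ((_ ∷ u≢v ∷ []) ∷ _)) , shortest) =
    u≢v , ¬uv , _ , a , b
    where
    ¬uv : ¬ Adj H u v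
    ¬uv c with s≤s () ← shortest 1 ((c ∷ []) , (u≢v ∷ []) ∷ [] ∷ [])

D² : Graph n → Graph n
D² H = record
  { Adj        = λ u v → IsDistance H u v 2
  ; adj-sym    = distance₂-sym H
  ; adj-irrefl = distance₂-irrefl H
  ; adj?       = distance₂? H
  }

infix 4 _≅_

_≅_ : Graph n → Graph m → Set
_≅_ {n} {m} G H = Σ (Fin n ↔ Fin m) λ f →
  ∀ u v → Adj G u v ⇔ Adj H (Inverse.to f u) (Inverse.to f v)

Is2DistanceGraph : Graph n → Set₁
Is2DistanceGraph G = ∃[ m ] Σ (Graph m) λ H → G ≅ D² H

IsClique : Graph n → Subset n → Set
IsClique G S = ∀ u v → u ∈ S → v ∈ S → u ≢ v → Adj G u v

IsCliqueNumber : Graph n → ℕ → Set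
IsCliqueNumber G k =
  (∃[ S ] (IsClique G S × ∣ S ∣ ≡ k)) × (∀ S → IsClique G S → ∣ S ∣ ≤ k)

isClique? : (G : Graph n) (S : Subset n) → Dec (IsClique G S)
isClique? G S = all? λ u → all? λ v →
  (u ∈? S) →-dec (v ∈? S) →-dec ¬? (u ≟ v) →-dec adj? G u v

cliqueNumber : (G : Graph n) → ∃ (IsCliqueNumber G)
cliqueNumber {n} G = search n λ S _ → ∣p∣≤n S
  where
  search : ∀ b → (∀ S → IsClique G S → ∣ S ∣ ≤ b) → ∃ (IsCliqueNumber G)
  search zero    bound =
    0 , (⊥ , (λ _ _ u∈⊥ → contradiction u∈⊥ ∉⊥) , ∣⊥∣≡0 n) , bound
  search (suc b) bound
    with anySubset? (λ S → isClique? G S ×-dec (∣ S ∣ ℕ.≟ suc b))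
  ... | yes largest = suc b , largest , bound
  ... | no none     = search b smaller
    where
    smaller : ∀ S → IsClique G S → ∣ S ∣ ≤ b
    smaller S c with ℕ.m≤n⇒m<n∨m≡n (bound S c)
    ... | inj₁ (s≤s ∣S∣≤b) = ∣S∣≤b
    ... | inj₂ ∣S∣≡1+b     = contradiction (S , c , ∣S∣≡1+b) none

ω : Graph n → ℕ
ω G = proj₁ (cliqueNumber G)

{-# OPTIONS --safe #-}
-- Let K be a clique of G = D²(H). Vertices of K are pairwise non-adjacent in H,
-- so H-neighbours of K lie outside K. Suppose at most two vertices lie outside K.
-- The ends of an edge of G and their common H-neighbour are neither all inside
-- nor all outside K, so by connectivity some k ∈ K is G-adjacent to some c ∉ K;
-- their common H-neighbour d is the other outside vertex. Since d is H-adjacent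
-- to c, a G-neighbour k′ of d lies in K. But the common H-neighbour of k and k′
-- can be neither c (not H-adjacent to k) nor d (not H-adjacent to k′).
module Submission where

open import Data.Fin.Base using (Fin; zero; suc)
open import Data.Fin.Properties using (_≟_)
open import Data.Fin.Subset using (Subset; _∈_; _∉_; ∣_∣; _-_; ∁)
open import Data.Fin.Subset.Properties
  using (_∈?_; x∉p⇒x∈∁p; x∈p∧x≢y⇒x∈p-y; x∈p⇒∣p-x∣<∣p∣; ∣∁p∣≡n∸∣p∣; ∣p∣≤n)
open import Data.List.Relation.Unary.All using ([]; _∷_)
open import Data.List.Relation.Unary.AllPairs using ([]; _∷_)
open import Data.Nat.Base using (ℕ; _+_; _≤_; z≤n; s≤s)
open import Data.Nat.Properties
  using (_≤?_; ≤-trans; +-monoʳ-≤; m+[n∸m]≡n; module ≤-Reasoning)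
open import Data.Product.Base using (∃-syntax; _×_; _,_; proj₁; proj₂)
open import Function.Base using (_∘_)
open import Function.Bundles using (module Inverse; module Equivalence)
open import Relation.Binary.PropositionalEquality
  using (_≡_; _≢_; refl; sym; cong; subst; ≢-sym)
open import Relation.Nullary using (yes; no)
open import Relation.Nullary.Decidable using (decidable-stable)
open import Relation.Nullary.Negation using (¬_; contradiction)
open import Defs

private
  variable
    n k : ℕ
    u v w : Fin n

-- Deleting `u`, `v` and `w` in turn from `∁ S` lowers its size strictly each time.
three-outside : (S : Subset n) → u ∉ S → v ∉ S → w ∉ S →
                u ≢ v → u ≢ w → v ≢ w → ∣ S ∣ + 3 ≤ n
three-outside {n} {u} {v} {w} S u∉S v∉S w∉S u≢v u≢w v≢w = begin
  ∣ S ∣ + 3       ≤⟨ +-monoʳ-≤ ∣ S ∣ 3≤∣∁S∣ ⟩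
  ∣ S ∣ + ∣ ∁ S ∣ ≡⟨ cong (∣ S ∣ +_) (∣∁p∣≡n∸∣p∣ S) ⟩
  ∣ S ∣ + _       ≡⟨ m+[n∸m]≡n (∣p∣≤n S) ⟩
  n               ∎
  where
  open ≤-Reasoning
  v∈ : v ∈ ∁ S - u
  v∈ = x∈p∧x≢y⇒x∈p-y (x∉p⇒x∈∁p v∉S) (≢-sym u≢v)
  w∈ : w ∈ ∁ S - u - v
  w∈ = x∈p∧x≢y⇒x∈p-y (x∈p∧x≢y⇒x∈p-y (x∉p⇒x∈∁p w∉S) (≢-sym u≢w)) (≢-sym v≢w)
  3≤∣∁S∣ : 3 ≤ ∣ ∁ S ∣
  3≤∣∁S∣ = ≤-trans
    (s≤s (≤-trans (s≤s (≤-trans (s≤s z≤n) (x∈p⇒∣p-x∣<∣p∣ w∈))) (x∈p⇒∣p-x∣<∣p∣ v∈)))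
    (x∈p⇒∣p-x∣<∣p∣ (x∉p⇒x∈∁p u∉S))

boundary-edge : (G : Graph n) (S : Subset n) → Walk G u v k → u ∈ S → v ∉ S →
                ∃[ x ] ∃[ y ] (x ∈ S × y ∉ S × Adj G x y)
boundary-edge G S [] u∈S u∉S = contradiction u∈S u∉S
boundary-edge G S (_∷_ {w = w} uw p) u∈S v∉S with w ∈? S
... | yes w∈S = boundary-edge G S p w∈S v∉S
... | no  w∉S = _ , _ , u∈S , w∉S , uw

neighbour : (G : Graph n) → Connected G → u ≢ v → ∃[ w ] Adj G u w
neighbour {u = u} {v} G conn u≢v with conn u v
... | _ , []     , _ = contradiction refl u≢v
... | _ , uw ∷ _ , _ = _ , uw

adj⇒≢ : (G : Graph n) → Adj G u v → u ≢ v
adj⇒≢ G uv u≡v = adj-irrefl G u≡v uv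

distance₂⇒≁ : (H : Graph n) → IsDistance H u v 2 → ¬ Adj H u v
distance₂⇒≁ H (_ , shortest) uv
  with s≤s () ← shortest 1 ((uv ∷ []) , (adj⇒≢ H uv ∷ []) ∷ [] ∷ [])

distance₂⇒common : (H : Graph n) → IsDistance H u v 2 → ∃[ w ] (Adj H u w × Adj H w v)
distance₂⇒common H (((uw ∷ wv ∷ []) , _) , _) = _ , uw , wv

pullback : ∀ {m} → (Fin n → Fin m) → Graph m → Graph n
pullback f H = record
  { Adj        = λ u v → Adj H (f u) (f v)
  ; adj-sym    = adj-sym H
  ; adj-irrefl = adj-irrefl H ∘ cong f
  ; adj?       = λ u v → adj? H (f u) (f v)
  }

-- The two local consequences of `G ≅ D² H` that drive the argument, with `H` moved onto the vertex
-- set of `G`.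
record IsRoot (G H : Graph n) : Set where
  field
    adj⇒≁      : Adj G u v → ¬ Adj H u v
    adj⇒common : Adj G u v → ∃[ w ] (Adj H u w × Adj H w v)

pullback-isRoot : ∀ {m} (G : Graph n) (H : Graph m) (iso : G ≅ D² H) →
                  IsRoot G (pullback (Inverse.to (proj₁ iso)) H)
pullback-isRoot G H (f , adj⇔) = record
  { adj⇒≁      = λ {u} {v} uv → distance₂⇒≁ H (distance₂ uv)
  ; adj⇒common = λ {u} {v} uv →
      -- The common neighbour `w` is a vertex of `H`; surjectivity of `f` carries it back to a
      -- vertex of `G`.
      let w , fuw , wfv = distance₂⇒common H (distance₂ uv)
          w≡f[f⁻¹w]     = sym (Inverse.strictlyInverseˡ f w)
      in  Inverse.from f w
        , subst (Adj H _) w≡f[f⁻¹w] fuw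
        , subst (λ x → Adj H x _) w≡f[f⁻¹w] wfv
  }
  where
  distance₂ : Adj G u v → IsDistance H (Inverse.to f u) (Inverse.to f v) 2
  distance₂ {u} {v} = Equivalence.to (adj⇔ u v)

module _ {n} (G H : Graph n) (root : IsRoot G H) (conn : Connected G)
         (K : Subset n) (clique : IsClique G K) where

  open IsRoot root

  H-neighbour-outside : u ∈ K → Adj H u v → v ∉ K
  H-neighbour-outside u∈K uv v∈K =
    adj⇒≁ (clique _ _ u∈K v∈K (adj⇒≢ H uv)) uv

  -- At most two vertices lie outside `K`, in the form that refuting the bound yields through
  -- `three-outside`.
  module _ (few : ∀ {x y z} → x ∉ K → y ∉ K → z ∉ K → x ≢ y → x ≢ z → ¬ y ≢ z)
           where

    outside-unique : ∀ {x y z} → x ∉ K → y ∉ K → z ∉ K → x ≢ y → x ≢ z → z ≡ y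
    outside-unique {y = y} {z} x∉K y∉K z∉K x≢y x≢z =
      decidable-stable (z ≟ y) λ z≢y → few x∉K y∉K z∉K x≢y x≢z (≢-sym z≢y)

    no-boundary-edge : ∀ {k c} → k ∈ K → c ∉ K → ¬ Adj G k c
    no-boundary-edge {k} {c} k∈K c∉K kc
      with d , kd , dc ← adj⇒common kc
      with d∉K ← H-neighbour-outside k∈K kd
      -- Here `k` serves as a vertex other than `d`, so connectivity gives `d` a `G`-neighbour.
      with k′ , dk′ ← neighbour G conn (λ d≡k → adj⇒≢ H kd (sym d≡k))
      with k′ ∈? K
    -- Outside `K` there is room only for `d` and `c`, so `k′` would be `c`, yet `d` is `H`-adjacent
    -- to `c`.
    ... | no k′∉K with refl ← outside-unique d∉K c∉K k′∉K (adj⇒≢ H dc) (adj⇒≢ G dk′)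
      = adj⇒≁ dk′ dc
    ... | yes k′∈K
      with e , ke , ek′ ← adj⇒common (clique k k′ k∈K k′∈K
                            λ { refl → adj⇒≁ dk′ (adj-sym H kd) })
      -- Since `e` is `H`-adjacent to `k′` and `d` is not, `e` must be `c`.
      with refl ← outside-unique d∉K c∉K (H-neighbour-outside k∈K ke) (adj⇒≢ H dc)
                    (λ { refl → adj⇒≁ dk′ ek′ })
      = adj⇒≁ kc ke

    no-inside-outside : u ∈ K → ¬ v ∉ K
    no-inside-outside {u} {v} u∈K v∉K =
      let _ , p , _              = conn u v
          _ , _ , x∈K , y∉K , xy = boundary-edge G K p u∈K v∉K
      in  no-boundary-edge x∈K y∉K xy

    no-edge : ¬ Adj G u v
    no-edge {u} {v} uv with w , uw , wv ← adj⇒common uv with u ∈? K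
    ... | yes u∈K = no-inside-outside u∈K (H-neighbour-outside u∈K uw)
    -- With `u` outside, `K` is empty, so `u`, `v`, `w` are three distinct outside vertices.
    ... | no  u∉K = few u∉K outside outside
                      (adj⇒≢ G uv) (adj⇒≢ H uw) (≢-sym (adj⇒≢ H wv))
      where
      outside : ∀ {x} → x ∉ K
      outside x∈K = no-inside-outside x∈K u∉K

  -- Decidability of `≤` permits contradiction; two distinct vertices and connectivity supply the
  -- edge that `no-edge` refutes.
  clique-bound : ∀ {u v : Fin n} → u ≢ v → ∣ K ∣ + 3 ≤ n
  clique-bound u≢v = decidable-stable (_ ≤? _) λ ≰ →
    no-edge (λ x∉K y∉K z∉K x≢y x≢z y≢z →
               ≰ (three-outside K x∉K y∉K z∉K x≢y x≢z y≢z))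
            (proj₂ (neighbour G conn u≢v))

ω-attained : (G : Graph n) → ∃[ K ] (IsClique G K × ∣ K ∣ ≡ ω G)
ω-attained G = proj₁ (proj₂ (cliqueNumber G))

proposition1 : (n : ℕ) → 2 ≤ n → (G : Graph n) → Connected G → Is2DistanceGraph G → ω G + 3 ≤ n
proposition1 n (s≤s (s≤s _)) G conn (_ , H , iso) =
  let K , clique , ∣K∣≡ω = ω-attained G
  in  subst (λ k → k + 3 ≤ n) ∣K∣≡ω
        (clique-bound G _ (pullback-isRoot G H iso) conn K clique
          -- Matching on `2 ≤ n` exposes two successors in `n`, so these two vertices exist.
          {zero} {suc zero} λ ())
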